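{- Let $M_1$ and $M_2$ be matroids on disjoint finite sets. The $\mathcal{G}$-invariant of the direct sum $M_1\oplus M_2$ is given by $$\mathcal{G}(M_1\oplus M_2)=\mathcal{G}(M_1)\wr\mathcal{G}(M_2),$$ where $\wr$ denotes the shuffle product.
   Context: An $(n,r)$-sequence is a $0,1$-sequence of length $n$ with exactly $r$ ones. $\mathcal{G}(n,r)$ is the vector space over a field of characteristic zero with basis the formal symbols $[\underline{r}]$, one for each $(n,r)$-sequence $\underline{r}$. For a rank-$r$ matroid $M$ with rank function $r(\cdot)$ on an $n$-element set $E$, and a permutation (linear ordering) $\pi$ of $E$, the rank sequence $\underline{r}(\pi)=r_1r_2\ldots r_n$ is given by $r_1=r(\{\pi(1)\})$ and $r_j=r(\{\pi(1),\ldots,\pi(j)\})-r(\{\pi(1),\ldots,\pi(j-1)\})$ for $j\ge2$. The $\mathcal{G}$-invariant is $\mathcal{G}(M)=\sum_{\pi}[\underline{r}(\pi)]\in\mathcal{G}(n,r)$, the sum over all $n!$ permutations of $E$. For sequences $(\alpha_1,\ldots,\alpha_m)$ and $(\beta_1,\ldots,\beta_n)$ and an $m$-element subset $P$ of $\{1,\ldots,m+n\}$, the shuffle $\mathrm{sh}((\alpha_i),(\beta_j);P)$ is the sequence of length $m+n$ obtained by inserting $(\alpha_i)$, in order, into the positions in $P$ and $(\beta_j)$, in order, into the remaining positions. For symbols $[\underline{r}]\in\mathcal{G}(n_1,r_1)$ and $[\underline{s}]\in\mathcal{G}(n_2,r_2)$, the shuffle product is $$[\underline{r}]\wr[\underline{s}]=\sum_{P\subseteq\{1,\ldots,n_1+n_2\},\,|P|=n_1}[\mathrm{sh}(\underline{r},\underline{s};P)]\in\mathcal{G}(n_1+n_2,r_1+r_2),$$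 extended bilinearly to $\mathcal{G}(n_1,r_1)\times\mathcal{G}(n_2,r_2)$. -}

module Defs where

open import Level using (Level; _⊔_) renaming (suc to lsuc)
open import Algebra.Apartness.Bundles using (HeytingCommutativeRing; HeytingField)
open import Algebra.Bundles using (CommutativeRing)
import Algebra.Definitions.RawMonoid as RawMonoidOps
import Algebra.Properties.CommutativeSemigroup as CommSemigroup
open import Data.Bool.Base using (Bool; true; false; _∧_; _∨_; if_then_else_)
open import Data.Bool.Properties using (∨-zeroʳ)
open import Data.Fin.Base using (Fin; zero; suc; toℕ; fromℕ<; splitAt; _↑ˡ_; _↑ʳ_)
open import Data.Fin.Properties as Fin
  using (any?; all?; toℕ-fromℕ<; toℕ-injective; toℕ<n; inj⇒≟; +↔⊎; splitAt-↑ˡ; splitAt-↑ʳ)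
open import Data.Fin.Subset using (∣_∣; ∁) renaming (Subset to Positions)
open import Data.Fin.Subset.Properties using (∣∁p∣≡n∸∣p∣)
open import Data.List.Base as List using (List; []; _∷_; cartesianProductWith; mapMaybe)
open import Data.Maybe.Base as Maybe using (Maybe)
open import Data.Nat.Base as ℕ using (ℕ; zero; suc; _+_; _∸_; _≤_; _<_; z≤n; s≤s)
open import Data.Nat.Properties as ℕ
  using ( +-assoc; +-comm; +-identityʳ; +-mono-≤; +-monoʳ-≤; +-cancelˡ-≡; +-cancelʳ-≤
        ; ≤-trans; ≤-reflexive; ≤-antisym; ≤-pred; m≤m+n; m∸n+n≡m; m+n∸m≡n; m≤n+o⇒m∸n≤o
        ; m<n⇒m<1+n; m≤n⇒m<n∨m≡n; n≤0⇒n≡0; n≮0; module ≤-Reasoning)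
open import Data.Product.Base using (Σ; Σ-syntax; ∃; _×_; _,_; proj₁; proj₂)
open import Data.Sum.Base using (_⊎_; inj₁; inj₂)
open import Data.Sum.Function.Propositional using (_⊎-↔_)
open import Data.Vec.Base as Vec using (Vec; []; _∷_; lookup; tabulate; count; cast)
import Data.Vec.Properties as Vec
open import Function.Base using (_∘_)
open import Function.Bundles using (Inverse; _↔_; _⇔_; mk⇔)
open import Function.Construct.Composition using (_↔-∘_)
open import Function.Construct.Symmetry using (↔-sym)
open import Function.Definitions using (Bijective; Injective; Surjective)
open import Function.Properties.Inverse using (↔⇒↣)
open import Relation.Binary.Definitions using (DecidableEquality)
open import Relation.Binary.PropositionalEquality hiding ([_])
open import Relation.Nullary using (¬_; Dec; yes; no; does; contradiction)
open import Relation.Nullary.Decidable using (map′; dec-true; _×-dec_; _→-dec_; dec⇒maybe)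
open import Relation.Unary using (Pred; Decidable)

private
  variable
    a b p c ℓ₁ ℓ₂ : Level
    A : Set a
    m n k r s : ℕ

words : List A → (n : ℕ) → List (Vec A n)
words xs zero    = [] ∷ []
words xs (suc n) = cartesianProductWith _∷_ xs (words xs n)

-- The members of a list satisfying P, each paired with a proof of P.
select : {P : Pred A p} → Decidable P → List A → List (Σ A P)
select P? = mapMaybe (λ x → Maybe.map (x ,_) (dec⇒maybe (P? x)))

record FiniteSet (n : ℕ) (a : Level) : Set (lsuc a) where
  field
    Carrier     : Set a
    enumeration : Fin n ↔ Carrier

  element : Fin n → Carrier
  element = Inverse.to enumeration

  index : Carrier → Fin n
  index = Inverse.from enumeration

  elements : List Carrier
  elements = List.tabulate element

  infix 4 _≟_
  _≟_ : DecidableEquality Carrier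
  _≟_ = inj⇒≟ (↔⇒↣ (↔-sym enumeration))

  element-index : ∀ e → element (index e) ≡ e
  element-index = Inverse.strictlyInverseˡ enumeration

  element-injective : ∀ {i j} → element i ≡ element j → i ≡ j
  element-injective {i} {j} eq =
    trans (sym (Inverse.strictlyInverseʳ enumeration i))
      (trans (cong index eq) (Inverse.strictlyInverseʳ enumeration j))

  Subset : Set a
  Subset = Carrier → Bool

  infix 4 _∈_ _⊆_
  infixr 6 _∪_
  infixr 7 _∩_

  _∈_ : Carrier → Subset → Set
  e ∈ X = X e ≡ true

  _⊆_ : Subset → Subset → Set a
  X ⊆ Y = ∀ e → e ∈ X → e ∈ Y

  _∪_ _∩_ : Subset → Subset → Subset
  (X ∪ Y) e = X e ∨ Y e
  (X ∩ Y) e = X e ∧ Y e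

  full : Subset
  full _ = true

  singleton : Carrier → Subset
  singleton e e′ = does (e ≟ e′)

  card : Subset → ℕ
  card X = ∣ tabulate (X ∘ element) ∣

-- A union of disjoint finite sets is rendered by the sum type.
_⊎ᶠ_ : FiniteSet m a → FiniteSet n b → FiniteSet (m + n) (a ⊔ b)
E₁ ⊎ᶠ E₂ = record
  { Carrier     = FiniteSet.Carrier E₁ ⊎ FiniteSet.Carrier E₂
  ; enumeration = (FiniteSet.enumeration E₁ ⊎-↔ FiniteSet.enumeration E₂) ↔-∘ +↔⊎
  }

does⁻ : {P : Set p} (d : Dec P) → does d ≡ true → P
does⁻ (yes q) _ = q

∣tabulate∣-empty : ∀ {n} (f : Fin n → Bool) → (∀ i → ¬ f i ≡ true) → ∣ tabulate f ∣ ≡ 0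
∣tabulate∣-empty {zero}  f h = refl
∣tabulate∣-empty {suc n} f h with f zero in eq
... | true  = contradiction eq (h zero)
... | false = ∣tabulate∣-empty (f ∘ suc) (h ∘ suc)

∣tabulate∣-≤1 : ∀ {n} (f : Fin n → Bool) →
  (∀ i j → f i ≡ true → f j ≡ true → i ≡ j) → ∣ tabulate f ∣ ≤ 1
∣tabulate∣-≤1 {zero}  f h = z≤n
∣tabulate∣-≤1 {suc n} f h with f zero in eq
... | true  = s≤s (≤-reflexive (∣tabulate∣-empty (f ∘ suc)
                (λ i fi → Fin.0≢1+n (h zero (suc i) eq fi))))
... | false = ∣tabulate∣-≤1 (f ∘ suc)
                (λ i j fi fj → Fin.suc-injective (h (suc i) (suc j) fi fj))

∣tabulate∣-+ : ∀ m (f : Fin (m + n) → Bool) →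
  ∣ tabulate f ∣ ≡ ∣ tabulate (f ∘ (_↑ˡ n)) ∣ + ∣ tabulate (f ∘ (m ↑ʳ_)) ∣
∣tabulate∣-+ zero    f = refl
∣tabulate∣-+ (suc m) f with f zero
... | true  = cong suc (∣tabulate∣-+ m (f ∘ suc))
... | false = ∣tabulate∣-+ m (f ∘ suc)

module _ (E : FiniteSet n a) where
  open FiniteSet E

  card-singleton : ∀ e → card (singleton e) ≤ 1
  card-singleton e = ∣tabulate∣-≤1 (singleton e ∘ element) λ i j p q →
    element-injective (trans (sym (does⁻ (e ≟ element i) p)) (does⁻ (e ≟ element j) q))

module _ (E₁ : FiniteSet m a) (E₂ : FiniteSet n b) where
  private
    module E₁ = FiniteSet E₁
    module E₂ = FiniteSet E₂
    module E  = FiniteSet (E₁ ⊎ᶠ E₂)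

  card-⊎ : ∀ X → E.card X ≡ E₁.card (X ∘ inj₁) + E₂.card (X ∘ inj₂)
  card-⊎ X = trans (∣tabulate∣-+ m (X ∘ E.element)) (cong₂ _+_
    (cong ∣_∣ (Vec.tabulate-cong λ i → cong (X ∘ elt) (splitAt-↑ˡ m i n)))
    (cong ∣_∣ (Vec.tabulate-cong λ i → cong (X ∘ elt) (splitAt-↑ʳ m n i))))
    where
    elt : Fin m ⊎ Fin n → E.Carrier
    elt = Inverse.to (E₁.enumeration ⊎-↔ E₂.enumeration)

-- A matroid is given by its rank function; an extensionality law for subsets
-- would be redundant, since it follows from monotone by antisymmetry.
record Matroid (E : FiniteSet n a) : Set a where
  open FiniteSet E
  field
    rk         : Subset → ℕ
    bounded    : ∀ X → rk X ≤ card X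
    monotone   : ∀ X Y → X ⊆ Y → rk X ≤ rk Y
    submodular : ∀ X Y → rk (X ∪ Y) + rk (X ∩ Y) ≤ rk X + rk Y

  rank : ℕ
  rank = rk full

  Independent : Subset → Set
  Independent X = rk X ≡ card X

module _ {E₁ : FiniteSet m a} {E₂ : FiniteSet n b} where
  private
    module E₁ = FiniteSet E₁
    module E₂ = FiniteSet E₂

  infixr 6 _⊕_
  _⊕_ : Matroid E₁ → Matroid E₂ → Matroid (E₁ ⊎ᶠ E₂)
  M₁ ⊕ M₂ = record
    { rk         = λ X → M₁.rk (X ∘ inj₁) + M₂.rk (X ∘ inj₂)
    ; bounded    = λ X → subst (_ ≤_) (sym (card-⊎ E₁ E₂ X))
                     (+-mono-≤ (M₁.bounded (X ∘ inj₁)) (M₂.bounded (X ∘ inj₂)))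
    ; monotone   = λ X Y X⊆Y → +-mono-≤ (M₁.monotone _ _ (X⊆Y ∘ inj₁))
                                        (M₂.monotone _ _ (X⊆Y ∘ inj₂))
    ; submodular = λ X Y → subst₂ _≤_
                     (interchange (M₁.rk _) (M₁.rk _) (M₂.rk _) (M₂.rk _))
                     (interchange (M₁.rk _) (M₁.rk _) (M₂.rk _) (M₂.rk _))
                     (+-mono-≤ (M₁.submodular (X ∘ inj₁) (Y ∘ inj₁))
                               (M₂.submodular (X ∘ inj₂) (Y ∘ inj₂)))
    }
    where
    module M₁ = Matroid M₁
    module M₂ = Matroid M₂
    open CommSemigroup ℕ.+-commutativeSemigroup using (interchange)

  -- The independent sets of M₁ ⊕ M₂ are the unions of an independent set of
  -- M₁ and one of M₂, so _⊕_ agrees with the definition by independent sets.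
  ⊕-independent : (M₁ : Matroid E₁) (M₂ : Matroid E₂) → ∀ X →
    Matroid.Independent (M₁ ⊕ M₂) X ⇔
      (Matroid.Independent M₁ (X ∘ inj₁) × Matroid.Independent M₂ (X ∘ inj₂))
  ⊕-independent M₁ M₂ X = mk⇔
    (λ eq → split (M₁.bounded _) (M₂.bounded _) (trans eq (card-⊎ E₁ E₂ X)))
    (λ (eq₁ , eq₂) → trans (cong₂ _+_ eq₁ eq₂) (sym (card-⊎ E₁ E₂ X)))
    where
    module M₁ = Matroid M₁
    module M₂ = Matroid M₂
    split : ∀ {x₁ x₂ y₁ y₂} → x₁ ≤ y₁ → x₂ ≤ y₂ → x₁ + x₂ ≡ y₁ + y₂ →
            x₁ ≡ y₁ × x₂ ≡ y₂
    split {x₁} {x₂} {y₁} {y₂} x₁≤y₁ x₂≤y₂ eq = x₁≡y₁ ,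
      +-cancelˡ-≡ y₁ x₂ y₂ (trans (cong (_+ x₂) (sym x₁≡y₁)) eq)
      where
      x₁≡y₁ : x₁ ≡ y₁
      x₁≡y₁ = ≤-antisym x₁≤y₁ (+-cancelʳ-≤ y₂ y₁ x₁
        (≤-trans (≤-reflexive (sym eq)) (+-monoʳ-≤ x₁ x₂≤y₂)))

ones : Vec (Fin 2) n → ℕ
ones = count (Fin._≟ suc zero)

Sequence : ℕ → ℕ → Set
Sequence n r = Σ[ v ∈ Vec (Fin 2) n ] ones v ≡ r

sequence≟ : DecidableEquality (Sequence n r)
sequence≟ (v , p) (w , q) = map′ (λ where refl → cong (v ,_) (ℕ.≡-irrelevant p q)) (cong proj₁)
  (Vec.≡-dec Fin._≟_ v w)

sequences : ∀ n r → List (Sequence n r)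
sequences n r = select (λ v → ones v ℕ.≟ r) (words (zero ∷ suc zero ∷ []) n)

ones-∷ : ∀ x (v : Vec (Fin 2) n) → ones (x ∷ v) ≡ toℕ x + ones v
ones-∷ zero       v = refl
ones-∷ (suc zero) v = refl

telescope : ∀ n (g : ℕ → ℕ) → (∀ i → g i ≤ g (suc i)) →
  (step : ∀ (j : Fin n) → g (suc (toℕ j)) ∸ g (toℕ j) < 2) →
  ones (tabulate (λ j → fromℕ< (step j))) + g 0 ≡ g n
telescope zero    g mono step = refl
telescope (suc n) g mono step = begin
  ones (d ∷ ds) + g 0        ≡⟨ cong (_+ g 0) (ones-∷ d ds) ⟩
  toℕ d + ones ds + g 0      ≡⟨ cong (λ x → x + ones ds + g 0) (toℕ-fromℕ< (step zero)) ⟩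
  (g 1 ∸ g 0) + ones ds + g 0 ≡⟨ cong (_+ g 0) (+-comm (g 1 ∸ g 0) (ones ds)) ⟩
  ones ds + (g 1 ∸ g 0) + g 0 ≡⟨ +-assoc (ones ds) (g 1 ∸ g 0) (g 0) ⟩
  ones ds + (g 1 ∸ g 0 + g 0) ≡⟨ cong (ones ds +_) (m∸n+n≡m (mono 0)) ⟩
  ones ds + g 1              ≡⟨ telescope n (g ∘ suc) (mono ∘ suc) (step ∘ suc) ⟩
  g (suc n)                  ∎
  where
  open ≡-Reasoning
  d  = fromℕ< (step zero)
  ds = tabulate (λ j → fromℕ< (step (suc j)))

module _ (E : FiniteSet n a) where
  open FiniteSet E

  -- A permutation π is recorded as the word π(1) π(2) … π(n).
  Ordering : Set a
  Ordering = Σ[ w ∈ Vec Carrier n ] Bijective _≡_ _≡_ (lookup w)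

  bijective? : (w : Vec Carrier n) → Dec (Bijective _≡_ _≡_ (lookup w))
  bijective? w = injective? ×-dec surjective?
    where
    injective? : Dec (Injective _≡_ _≡_ (lookup w))
    injective? = map′ (λ h {i} {j} → h i j) (λ h i j → h {i} {j})
      (all? λ i → all? λ j → (lookup w i ≟ lookup w j) →-dec (i Fin.≟ j))

    hits-all⇒surjective : (∀ j → ∃ λ i → lookup w i ≡ element j) →
                          Surjective _≡_ _≡_ (lookup w)
    hits-all⇒surjective h e with h (index e)
    ... | i , eq = i , λ where refl → trans eq (element-index e)

    surjective⇒hits-all : Surjective _≡_ _≡_ (lookup w) →
                          ∀ j → ∃ λ i → lookup w i ≡ element j
    surjective⇒hits-all h j with h (element j)
    ... | i , eq = i , eq refl

    surjective? : Dec (Surjective _≡_ _≡_ (lookup w))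
    surjective? = map′ hits-all⇒surjective surjective⇒hits-all
      (all? λ j → any? λ i → lookup w i ≟ element j)

  orderings : List Ordering
  orderings = select bijective? (words elements n)

  -- {π(1), …, π(k)}
  initial : Vec Carrier n → ℕ → Subset
  initial w k e = does (any? λ i → (toℕ i ℕ.<? k) ×-dec (lookup w i ≟ e))

module _ {E : FiniteSet n a} (M : Matroid E) where
  open FiniteSet E
  open Matroid M

  initial⁺ : ∀ w {k} i → toℕ i < k → lookup w i ∈ initial E w k
  initial⁺ w i i<k = dec-true (any? _) (i , i<k , refl)

  initial⁻ : ∀ w k e → e ∈ initial E w k → ∃ λ i → toℕ i < k × lookup w i ≡ e
  initial⁻ w k e = does⁻ (any? _)

  initial-monotone : ∀ w k → rk (initial E w k) ≤ rk (initial E w (suc k))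
  initial-monotone w k = monotone _ _ λ e e∈ →
    let i , i<k , eq = initial⁻ w k e e∈ in
    subst (_∈ initial E w (suc k)) eq (initial⁺ w i (m<n⇒m<1+n i<k))

  initial-suc : ∀ w (j : Fin n) →
    initial E w (suc (toℕ j)) ⊆ (initial E w (toℕ j) ∪ singleton (lookup w j))
  initial-suc w j e e∈ with initial⁻ w (suc (toℕ j)) e e∈
  ... | i , i<1+j , refl with m≤n⇒m<n∨m≡n (≤-pred i<1+j)
  ...   | inj₁ i<j = cong (_∨ singleton (lookup w j) e) (initial⁺ w i i<j)
  ...   | inj₂ i≡j = trans
    (cong (initial E w (toℕ j) e ∨_)
      (dec-true (lookup w j ≟ e) (cong (lookup w) (sym (toℕ-injective i≡j)))))
    (∨-zeroʳ _)

  rank-initial-0 : ∀ w → rk (initial E w 0) ≡ 0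
  rank-initial-0 w = n≤0⇒n≡0 (≤-trans (bounded _) (≤-reflexive
    (∣tabulate∣-empty (initial E w 0 ∘ element) λ i e∈ →
      let _ , i<0 , _ = initial⁻ w 0 (element i) e∈ in n≮0 i<0)))

  rank-initial-n : (π : Ordering E) → rk (initial E (proj₁ π) n) ≡ rank
  rank-initial-n (w , _ , surj) = ≤-antisym
    (monotone _ _ λ _ _ → refl)
    (monotone _ _ λ e _ → let i , eq = surj e in
      subst (_∈ initial E w n) (eq refl) (initial⁺ w i (toℕ<n i)))

  increment<2 : ∀ w (j : Fin n) →
    rk (initial E w (suc (toℕ j))) ∸ rk (initial E w (toℕ j)) < 2
  increment<2 w j = s≤s (m≤n+o⇒m∸n≤o _ (rk (X (toℕ j))) (begin
    rk (X (suc (toℕ j)))                      ≤⟨ monotone _ _ (initial-suc w j) ⟩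
    rk (X (toℕ j) ∪ x)                        ≤⟨ m≤m+n _ _ ⟩
    rk (X (toℕ j) ∪ x) + rk (X (toℕ j) ∩ x)   ≤⟨ submodular _ _ ⟩
    rk (X (toℕ j)) + rk x
      ≤⟨ +-monoʳ-≤ (rk (X (toℕ j))) (≤-trans (bounded x) (card-singleton E (lookup w j))) ⟩
    rk (X (toℕ j)) + 1                        ∎))
    where
    open ≤-Reasoning
    X = initial E w
    x = singleton (lookup w j)

  -- The first entry is r({π(1)}) - r(∅), which is r({π(1)}) because r(∅) = 0.
  -- Neither ∸ nor fromℕ< truncates: by monotone and increment<2 every
  -- increment is 0 or 1.
  rankSequence : Ordering E → Sequence n rank
  rankSequence π@(w , _) = tabulate (λ j → fromℕ< (increment<2 w j)) , (begin
    ones v                        ≡⟨ +-identityʳ (ones v) ⟨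
    ones v + 0                    ≡⟨ cong (ones v +_) (rank-initial-0 w) ⟨
    ones v + rk (initial E w 0)   ≡⟨ telescope n (λ k → rk (initial E w k))
                                       (initial-monotone w) (increment<2 w) ⟩
    rk (initial E w n)            ≡⟨ rank-initial-n π ⟩
    rank                          ∎)
    where
    open ≡-Reasoning
    v = tabulate (λ j → fromℕ< (increment<2 w j))

interleave : (P : Positions k) → Vec A ∣ P ∣ → Vec A ∣ ∁ P ∣ → Vec A k
interleave []          αs       βs       = []
interleave (true  ∷ P) (α ∷ αs) βs       = α ∷ interleave P αs βs
interleave (false ∷ P) αs       (β ∷ βs) = β ∷ interleave P αs βs

PositionSet : ℕ → ℕ → Set
PositionSet m n = Σ[ P ∈ Positions (m + n) ] ∣ P ∣ ≡ m

positionSets : ∀ m n → List (PositionSet m n)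
positionSets m n = select (λ P → ∣ P ∣ ℕ.≟ m) (words (true ∷ false ∷ []) (m + n))

∣∁∣ : ((P , _) : PositionSet m n) → ∣ ∁ P ∣ ≡ n
∣∁∣ {m} {n} (P , eq) =
  trans (∣∁p∣≡n∸∣p∣ P) (trans (cong (m + n ∸_) eq) (m+n∸m≡n m n))

-- P of size m in m + n positions has a complement of size n; the casts only
-- transport along these two equations.
sh : Vec A m → Vec A n → PositionSet m n → Vec A (m + n)
sh αs βs 𝑷@(P , eq) = interleave P (cast (sym eq) αs) (cast (sym (∣∁∣ 𝑷)) βs)

ones-cast : (eq : m ≡ n) (v : Vec (Fin 2) m) → ones (cast eq v) ≡ ones v
ones-cast refl v = cong ones (Vec.cast-is-id refl v)

ones-interleave : ∀ (P : Positions k) αs βs →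
  ones (interleave P αs βs) ≡ ones αs + ones βs
ones-interleave []          []       []       = refl
ones-interleave (true  ∷ P) (α ∷ αs) βs       = begin
  ones (α ∷ interleave P αs βs)        ≡⟨ ones-∷ α (interleave P αs βs) ⟩
  toℕ α + ones (interleave P αs βs)    ≡⟨ cong (toℕ α +_) (ones-interleave P αs βs) ⟩
  toℕ α + (ones αs + ones βs)          ≡⟨ +-assoc (toℕ α) _ _ ⟨
  toℕ α + ones αs + ones βs            ≡⟨ cong (_+ ones βs) (ones-∷ α αs) ⟨
  ones (α ∷ αs) + ones βs              ∎
  where open ≡-Reasoning
ones-interleave (false ∷ P) αs       (β ∷ βs) = begin
  ones (β ∷ interleave P αs βs)        ≡⟨ ones-∷ β (interleave P αs βs) ⟩
  toℕ β + ones (interleave P αs βs)    ≡⟨ cong (toℕ β +_) (ones-interleave P αs βs) ⟩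
  toℕ β + (ones αs + ones βs)          ≡⟨ x∙yz≈y∙xz (toℕ β) (ones αs) (ones βs) ⟩
  ones αs + (toℕ β + ones βs)          ≡⟨ cong (ones αs +_) (ones-∷ β βs) ⟨
  ones αs + ones (β ∷ βs)              ∎
  where
  open ≡-Reasoning
  open CommSemigroup ℕ.+-commutativeSemigroup using (x∙yz≈y∙xz)

shuffle : Sequence m r → Sequence n s → PositionSet m n → Sequence (m + n) (r + s)
shuffle (αs , p) (βs , q) 𝑷@(P , eq) = sh αs βs 𝑷 ,
  trans (ones-interleave P (cast (sym eq) αs) (cast (sym (∣∁∣ 𝑷)) βs))
    (cong₂ _+_ (trans (ones-cast (sym eq) αs) p) (trans (ones-cast (sym (∣∁∣ 𝑷)) βs) q))

CharacteristicZero : HeytingField c ℓ₁ ℓ₂ → Set ℓ₁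
CharacteristicZero K = ∀ n → ¬ (suc n · 1#) ≈ 0#
  where
  open HeytingCommutativeRing (HeytingField.heytingCommutativeRing K) using (commutativeRing)
  open CommutativeRing commutativeRing using (_≈_; 0#; 1#; +-rawMonoid)
  open RawMonoidOps +-rawMonoid using () renaming (_×_ to _·_)

module GInvariant (K : HeytingField c ℓ₁ ℓ₂) where

  private
    module K = HeytingField K

  -- As there are finitely many (n,r)-sequences, the space with basis the
  -- symbols [ s ] is the space of coefficient functions.
  Space : ℕ → ℕ → Set c
  Space n r = Sequence n r → K.Carrier

  infix  4 _≈_
  infixl 6 _⊞_
  infixr 7 _•_
  infixl 7 _≀_

  _≈_ : Space n r → Space n r → Set ℓ₁
  f ≈ g = ∀ s → f s K.≈ g s

  _⊞_ : Space n r → Space n r → Space n r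
  (f ⊞ g) s = f s K.+ g s

  𝟎 : Space n r
  𝟎 _ = K.0#

  _•_ : K.Carrier → Space n r → Space n r
  (x • f) s = x K.* f s

  ∑ : List A → (A → Space n r) → Space n r
  ∑ xs f = List.foldr (λ x → f x ⊞_) 𝟎 xs

  [_] : Sequence n r → Space n r
  [ s ] t = if does (sequence≟ s t) then K.1# else K.0#

  𝒢 : {E : FiniteSet n a} (M : Matroid E) → Space n (Matroid.rank M)
  𝒢 {E = E} M = ∑ (orderings E) λ π → [ rankSequence M π ]

  [_]≀[_] : Sequence m r → Sequence n s → Space (m + n) (r + s)
  [_]≀[_] {m = m} {n = n} u v = ∑ (positionSets m n) λ P → [ shuffle u v P ]

  _≀_ : Space m r → Space n s → Space (m + n) (r + s)
  _≀_ {m} {r} {n} {s} f g =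
    ∑ (sequences m r) λ u → ∑ (sequences n s) λ v → (f u K.* g v) • [ u ]≀[ v ]

{-# OPTIONS --safe #-}

-- A word in E₁ ⊎ E₂ is the same thing as a position set P together with a word
-- in E₁ of length |P| and a word in E₂ of length |∁ P|.  It is an ordering of
-- E₁ ⊎ E₂ iff each of the two words exhausts its set, which forces |P| = |E₁|
-- and makes both words orderings.  The rank of M₁ ⊕ M₂ being additive, a letter
-- of E₁ raises it by what it adds to the preceding letters of E₁ alone, so rank
-- sequences shuffle along with the orderings.  Expanding 𝒢 M₁ ≀ 𝒢 M₂ bilinearly
-- leaves the same sum over pairs of orderings and position sets.

module Submission where

open import Defs
open import Algebra.Apartness.Bundles using (HeytingField; HeytingCommutativeRing)
open import Algebra.Bundles using (CommutativeRing)
import Algebra.Properties.CommutativeSemigroup as CommSemigroup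
open import Data.Bool.Base using (true; false; _∨_)
open import Data.Bool.Properties using (∨-zeroʳ; ∨-identityʳ)
open import Data.Fin.Base as Fin using (Fin; zero; suc; toℕ; fromℕ<; _↑ˡ_; _↑ʳ_; punchOut)
open import Data.Fin.Properties as Fin
  using (any?; injective⇒≤; punchOut-injective; splitAt-↑ˡ; splitAt-↑ʳ; toℕ-fromℕ<)
open import Data.Fin.Subset using (∣_∣; ∁) renaming (Subset to Positions)
open import Data.Fin.Subset.Properties using (∣∁p∣≡n∸∣p∣; ∣p∣≤n)
open import Data.List.Base as List using (List; []; _∷_; _++_; cartesianProductWith)
open import Data.List.Properties as List using (map-tabulate)
open import Data.Nat.Base using (ℕ; zero; suc; _+_; _∸_; _≤_; _<_; z≤n; s≤s)
open import Data.Nat.Properties as ℕ using ([m+n]∸[m+o]≡n∸o)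
open import Data.Product.Base using (Σ; ∃; _×_; _,_; proj₁; proj₂)
open import Data.Sum.Base as Sum using (_⊎_; inj₁; inj₂)
open import Data.Vec.Base as Vec using (Vec; []; _∷_; lookup; tabulate; cast)
open import Data.Vec.Membership.Propositional using () renaming (_∈_ to _∈ᵛ_)
open import Data.Vec.Membership.Propositional.Properties using (∈-lookup; ∈-map⁺)
open import Data.Vec.Properties as Vec using (tabulate-cong; tabulate-∘; map-cast; cast-is-id)
open import Data.Vec.Relation.Unary.Any as Any using (here; there)
open import Data.Vec.Relation.Unary.Any.Properties using (lookup-index)
open import Function.Base using (_∘_)
open import Function.Bundles using (_⇔_; mk⇔; Equivalence)
open import Function.Definitions using (Bijective; Injective)
open import Level using (Level)
open import Relation.Binary.PropositionalEquality
  using (_≡_; _≢_; _≗_; refl; sym; trans; cong; cong₂; subst; module ≡-Reasoning)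
open import Relation.Nullary using (¬_; Dec; yes; no; contradiction)
open import Relation.Nullary.Decidable using (dec-true; dec-false; does-⇔)
open import Relation.Unary using (Pred; Decidable; Irrelevant)

private
  variable
    a b p p₁ p₂ c ℓ ℓ₁ ℓ₂ : Level
    A B C : Set a
    k l m n r s : ℕ

-- Covering words and their interleavings

Fin-injective⇒surjective : {f : Fin n → Fin n} → Injective _≡_ _≡_ f → ∀ j → ∃ λ i → f i ≡ j
Fin-injective⇒surjective {suc n} {f} inj j with any? (λ i → f i Fin.≟ j)
... | yes hit = hit
-- If `j` were missed, punching it out would inject `Fin (suc n)` into `Fin n`.
... | no miss = contradiction
  (injective⇒≤ {f = λ i → punchOut (j≢ i)} λ {i} {i′} →
    inj ∘ punchOut-injective (j≢ i) (j≢ i′))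
  ℕ.1+n≰n
  where
  j≢ : ∀ i → j ≢ f i
  j≢ i eq = miss (i , sym eq)

map-injective : {f : A → B} → Injective _≡_ _≡_ f → {v w : Vec A n} →
  Vec.map f v ≡ Vec.map f w → v ≡ w
map-injective inj {[]}    {[]}    eq = refl
map-injective inj {x ∷ v} {y ∷ w} eq =
  cong₂ _∷_ (inj (Vec.∷-injectiveˡ eq)) (map-injective inj (Vec.∷-injectiveʳ eq))

-- Surjectivity phrased by membership makes sense for words of any length. It therefore applies to
-- the two pieces of an interleaving before their lengths are known.
Covers : {A : Set a} → Vec A n → Set a
Covers w = ∀ e → e ∈ᵛ w

covers-cast : (eq : m ≡ n) (w : Vec A m) → Covers w ⇔ Covers (cast eq w)
covers-cast refl w = mk⇔ (subst Covers (sym (cast-is-id refl w))) (subst Covers (cast-is-id refl w))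

module _ (E : FiniteSet n a) where
  open FiniteSet E

  position : {w : Vec Carrier l} → Covers w → Fin n → Fin l
  position cov i = Any.index (cov (element i))

  lookup-position : {w : Vec Carrier l} (cov : Covers w) → ∀ i → element i ≡ lookup w (position cov i)
  lookup-position cov i = lookup-index (cov (element i))

  position-injective : {w : Vec Carrier l} (cov : Covers w) → Injective _≡_ _≡_ (position cov)
  position-injective {w = w} cov {i} {j} eq = element-injective
    (trans (lookup-position cov i) (trans (cong (lookup w) eq) (sym (lookup-position cov j))))

  covers⇒≤ : {w : Vec Carrier l} → Covers w → n ≤ l
  covers⇒≤ cov = injective⇒≤ (position-injective cov)

  -- From right to left, `position cov` is an injection of `Fin n` into itself, hence onto, so each
  -- index of `w` is the chosen position of some element. Equal letters then belong to the same
  -- element and so to the same index.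
  bijective⇔covers : {w : Vec Carrier n} → Bijective _≡_ _≡_ (lookup w) ⇔ Covers w
  bijective⇔covers {w} = mk⇔
    covers
    (λ cov → injective cov , λ e → Any.index (cov e) , λ where refl → sym (lookup-index (cov e)))
    where
    covers : Bijective _≡_ _≡_ (lookup w) → Covers w
    covers (_ , surj) e with i , eq ← surj e = subst (_∈ᵛ w) (eq refl) (∈-lookup i w)

    injective : Covers w → Injective _≡_ _≡_ (lookup w)
    injective cov {i} {j} eq
      with Fin-injective⇒surjective (position-injective cov) i
         | Fin-injective⇒surjective (position-injective cov) j
    ... | i′ , refl | j′ , refl = cong (position cov) (element-injective
      (trans (lookup-position cov i′) (trans eq (sym (lookup-position cov j′)))))

∈-interleave⁺ˡ : ∀ (P : Positions k) {αs : Vec A _} {βs e} → e ∈ᵛ αs → e ∈ᵛ interleave P αs βs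
∈-interleave⁺ˡ (true  ∷ P) {α ∷ αs}          (here eq)  = here eq
∈-interleave⁺ˡ (true  ∷ P) {α ∷ αs}          (there e∈) = there (∈-interleave⁺ˡ P e∈)
∈-interleave⁺ˡ (false ∷ P) {αs}     {β ∷ βs} e∈         = there (∈-interleave⁺ˡ P e∈)

∈-interleave⁺ʳ : ∀ (P : Positions k) {αs : Vec A _} {βs e} → e ∈ᵛ βs → e ∈ᵛ interleave P αs βs
∈-interleave⁺ʳ (true  ∷ P) {α ∷ αs}          e∈         = there (∈-interleave⁺ʳ P e∈)
∈-interleave⁺ʳ (false ∷ P) {αs}     {β ∷ βs} (here eq)  = here eq
∈-interleave⁺ʳ (false ∷ P) {αs}     {β ∷ βs} (there e∈) = there (∈-interleave⁺ʳ P e∈)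

map-interleave : (f : A → B) (P : Positions k) → ∀ αs βs →
  Vec.map f (interleave P αs βs) ≡ interleave P (Vec.map f αs) (Vec.map f βs)
map-interleave f []          []       []       = refl
map-interleave f (true  ∷ P) (α ∷ αs) βs       = cong (f α ∷_) (map-interleave f P αs βs)
map-interleave f (false ∷ P) αs       (β ∷ βs) = cong (f β ∷_) (map-interleave f P αs βs)

-- The tags make `P` and both pieces recoverable from the resulting word: `true` marks the letters
-- of the left set.
interleave-⊎ : (P : Positions k) → Vec A ∣ P ∣ → Vec B ∣ ∁ P ∣ → Vec (A ⊎ B) k
interleave-⊎ P αs βs = interleave P (Vec.map inj₁ αs) (Vec.map inj₂ βs)

inj₁-∈-interleave-⊎ : ∀ (P : Positions k) {αs : Vec A _} {βs : Vec B _} {e} →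
  inj₁ e ∈ᵛ interleave-⊎ P αs βs → e ∈ᵛ αs
inj₁-∈-interleave-⊎ (true  ∷ P) {α ∷ αs}          (here refl) = here refl
inj₁-∈-interleave-⊎ (true  ∷ P) {α ∷ αs}          (there e∈)  = there (inj₁-∈-interleave-⊎ P e∈)
inj₁-∈-interleave-⊎ (false ∷ P) {αs}     {β ∷ βs} (there e∈)  = inj₁-∈-interleave-⊎ P e∈

inj₂-∈-interleave-⊎ : ∀ (P : Positions k) {αs : Vec A _} {βs : Vec B _} {e} →
  inj₂ e ∈ᵛ interleave-⊎ P αs βs → e ∈ᵛ βs
inj₂-∈-interleave-⊎ (true  ∷ P) {α ∷ αs}          (there e∈)  = inj₂-∈-interleave-⊎ P e∈
inj₂-∈-interleave-⊎ (false ∷ P) {αs}     {β ∷ βs} (here refl) = here refl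
inj₂-∈-interleave-⊎ (false ∷ P) {αs}     {β ∷ βs} (there e∈)  = there (inj₂-∈-interleave-⊎ P e∈)

covers-interleave-⊎ : ∀ (P : Positions k) {αs : Vec A _} {βs : Vec B _} →
  Covers (interleave-⊎ P αs βs) ⇔ (Covers αs × Covers βs)
covers-interleave-⊎ P = mk⇔
  (λ cov → (λ e → inj₁-∈-interleave-⊎ P (cov (inj₁ e))) ,
           (λ e → inj₂-∈-interleave-⊎ P (cov (inj₂ e))))
  λ where
    (cov₁ , cov₂) (inj₁ e) → ∈-interleave⁺ˡ P (∈-map⁺ inj₁ (cov₁ e))
    (cov₁ , cov₂) (inj₂ e) → ∈-interleave⁺ʳ P (∈-map⁺ inj₂ (cov₂ e))

module _ (E₁ : FiniteSet m a) (E₂ : FiniteSet n b) (P : Positions (m + n))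
  {αs : Vec (FiniteSet.Carrier E₁) ∣ P ∣} {βs : Vec (FiniteSet.Carrier E₂) ∣ ∁ P ∣} where

  -- The pieces have lengths at least `m` and at least `n`, but these lengths add up to `m + n`, so
  -- neither bound can be strict.
  covers-interleave⇒∣P∣ : Covers (interleave-⊎ P αs βs) → ∣ P ∣ ≡ m
  covers-interleave⇒∣P∣ cov with Equivalence.to (covers-interleave-⊎ P) cov
  ... | cov₁ , cov₂ = ℕ.≤-antisym (ℕ.+-cancelʳ-≤ n _ _ (begin
    ∣ P ∣ + n                   ≤⟨ ℕ.+-monoʳ-≤ ∣ P ∣ (covers⇒≤ E₂ cov₂) ⟩
    ∣ P ∣ + ∣ ∁ P ∣             ≡⟨ cong (∣ P ∣ +_) (∣∁p∣≡n∸∣p∣ P) ⟩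
    ∣ P ∣ + (m + n ∸ ∣ P ∣)     ≡⟨ ℕ.m+[n∸m]≡n (∣p∣≤n P) ⟩
    m + n                       ∎)) (covers⇒≤ E₁ cov₁)
    where open ℕ.≤-Reasoning

-- The counterpart of `sh` on orderings. It uses the same casts, so that rank sequences can be
-- compared with `shuffle` piece by piece.
combine : PositionSet m n → Vec A m → Vec B n → Vec (A ⊎ B) (m + n)
combine 𝑷@(P , eq) αs βs = interleave-⊎ P (cast (sym eq) αs) (cast (sym (∣∁∣ 𝑷)) βs)

combine-bijective : (E₁ : FiniteSet m a) (E₂ : FiniteSet n b) (𝑷 : PositionSet m n) →
  (αs : Vec (FiniteSet.Carrier E₁) m) (βs : Vec (FiniteSet.Carrier E₂) n) →
  Bijective _≡_ _≡_ (lookup (combine 𝑷 αs βs)) ⇔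
  (Bijective _≡_ _≡_ (lookup αs) × Bijective _≡_ _≡_ (lookup βs))
combine-bijective E₁ E₂ 𝑷@(P , eq) αs βs = mk⇔
  (λ bij → let cov₁ , cov₂ = to (covers-interleave-⊎ P) (to (bijective⇔covers (E₁ ⊎ᶠ E₂)) bij) in
    from (bijective⇔covers E₁) (from (covers-cast (sym eq) αs) cov₁) ,
    from (bijective⇔covers E₂) (from (covers-cast (sym (∣∁∣ 𝑷)) βs) cov₂))
  (λ (bij₁ , bij₂) → from (bijective⇔covers (E₁ ⊎ᶠ E₂)) (from (covers-interleave-⊎ P)
    (to (covers-cast (sym eq) αs) (to (bijective⇔covers E₁) bij₁) ,
     to (covers-cast (sym (∣∁∣ 𝑷)) βs) (to (bijective⇔covers E₂) bij₂))))
  where open Equivalence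

-- Rank increments

module _ (E : FiniteSet n a) where
  open FiniteSet E

  -- An accumulating form of `initial`: letters are added one at a time to a start set, which is
  -- what allows induction along the word.
  reach : Subset → Vec Carrier l → ℕ → Subset
  reach X w       zero    = X
  reach X []      (suc k) = X
  reach X (e ∷ w) (suc k) = reach (X ∪ singleton e) w k

  reach⁺ : ∀ X (w : Vec Carrier l) k {e} → e ∈ X → e ∈ reach X w k
  reach⁺ X w       zero    e∈ = e∈
  reach⁺ X []      (suc k) e∈ = e∈
  reach⁺ X (x ∷ w) (suc k) e∈ = reach⁺ _ w k (cong (_∨ _) e∈)

  reach⁺-lookup : ∀ X (w : Vec Carrier l) k i → toℕ i < k → lookup w i ∈ reach X w k
  reach⁺-lookup X (x ∷ w) (suc k) zero    _         =
    reach⁺ _ w k (trans (cong (X x ∨_) (dec-true (x ≟ x) refl)) (∨-zeroʳ _))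
  reach⁺-lookup X (x ∷ w) (suc k) (suc i) (s≤s i<k) = reach⁺-lookup _ w k i i<k

  reach⁻ : ∀ X (w : Vec Carrier l) k {e} → e ∈ reach X w k →
    e ∈ X ⊎ ∃ λ i → toℕ i < k × lookup w i ≡ e
  reach⁻ X w       zero    e∈ = inj₁ e∈
  reach⁻ X []      (suc k) e∈ = inj₁ e∈
  reach⁻ X (x ∷ w) (suc k) {e} e∈ with reach⁻ _ w k e∈
  ... | inj₂ (i , i<k , eq) = inj₂ (suc i , s≤s i<k , eq)
  ... | inj₁ e∈′ with X e
  ...   | true  = inj₁ refl
  ...   | false = inj₂ (zero , s≤s z≤n , does⁻ (x ≟ e) e∈′)

  -- Values in `ℕ` avoid carrying the bounds required by `fromℕ<` through the induction.
  increments : (Subset → ℕ) → Subset → Vec Carrier l → Vec ℕ l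
  increments ρ X []      = []
  increments ρ X (e ∷ w) = (ρ (X ∪ singleton e) ∸ ρ X) ∷ increments ρ (X ∪ singleton e) w

  increments-reach : ∀ ρ X (w : Vec Carrier l) →
    increments ρ X w ≡ tabulate λ j → ρ (reach X w (suc (toℕ j))) ∸ ρ (reach X w (toℕ j))
  increments-reach ρ X []      = refl
  increments-reach ρ X (e ∷ w) = cong (_ ∷_) (increments-reach ρ _ w)

  increments-cast : ∀ ρ X (eq : l ≡ k) (w : Vec Carrier l) →
    increments ρ X (cast eq w) ≡ cast eq (increments ρ X w)
  increments-cast ρ X refl w =
    trans (cong (increments ρ X) (cast-is-id refl w)) (sym (cast-is-id refl _))

module _ {E : FiniteSet n a} (M : Matroid E) where
  open FiniteSet E
  open Matroid M

  -- Stands in for function extensionality on subsets, which are Boolean functions here.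
  rk-cong : ∀ {X Y} → X ≗ Y → rk X ≡ rk Y
  rk-cong X≗Y = ℕ.≤-antisym
    (monotone _ _ λ e → trans (sym (X≗Y e))) (monotone _ _ λ e → trans (X≗Y e))

  initial≗reach : ∀ w k → initial E w k ≗ reach E (λ _ → false) w k
  initial≗reach w k e with initial E w k e in eq | reach E (λ _ → false) w k e in eq′
  ... | true  | true  = refl
  ... | false | false = refl
  -- In the two mixed cases the goal is itself the contradiction: an index witnessing membership in
  -- one set puts `e` into the other. The start set is empty, so `reach⁻` can only return an index.
  ... | true  | false with initial⁻ M w k e eq
  ...   | i , i<k , refl = trans (sym (reach⁺-lookup E _ w k i i<k)) eq′
  initial≗reach w k e | false | true with reach⁻ E _ w k eq′
  ...   | inj₂ (i , i<k , refl) = trans (sym eq) (initial⁺ M w i i<k)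

  rankIncrements : Vec Carrier l → Vec ℕ l
  rankIncrements = increments E rk (λ _ → false)

  -- Mapping to `ℕ` discards the bound proofs inside `fromℕ<`, leaving the recursively computed
  -- increments.
  toℕ-rankSequence : (π : Ordering E) →
    Vec.map toℕ (proj₁ (rankSequence M π)) ≡ rankIncrements (proj₁ π)
  toℕ-rankSequence (w , _) = begin
    Vec.map toℕ (tabulate λ j → fromℕ< (increment<2 M w j))
      ≡⟨ tabulate-∘ toℕ _ ⟨
    tabulate (λ j → toℕ (fromℕ< (increment<2 M w j)))
      ≡⟨ tabulate-cong (λ j → trans (toℕ-fromℕ< (increment<2 M w j)) (cong₂ _∸_
           (rk-cong (initial≗reach w (suc (toℕ j)))) (rk-cong (initial≗reach w (toℕ j))))) ⟩
    tabulate (λ j → rk (reach E _ w (suc (toℕ j))) ∸ rk (reach E _ w (toℕ j)))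
      ≡⟨ increments-reach E rk _ w ⟨
    rankIncrements w
      ∎
    where open ≡-Reasoning

module _ (E₁ : FiniteSet m a) (E₂ : FiniteSet n b) where
  private
    module E₁ = FiniteSet E₁
    module E₂ = FiniteSet E₂
    module E  = FiniteSet (E₁ ⊎ᶠ E₂)

  singleton-inj₁ : ∀ e e′ → E.singleton (inj₁ e) (inj₁ e′) ≡ E₁.singleton e e′
  singleton-inj₁ e e′ = does-⇔ (mk⇔ (λ where refl → refl) (cong inj₁))
    (inj₁ e E.≟ inj₁ e′) (e E₁.≟ e′)

  singleton-inj₂ : ∀ e e′ → E.singleton (inj₂ e) (inj₂ e′) ≡ E₂.singleton e e′
  singleton-inj₂ e e′ = does-⇔ (mk⇔ (λ where refl → refl) (cong inj₂))
    (inj₂ e E.≟ inj₂ e′) (e E₂.≟ e′)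

  singleton-inj₁-inj₂ : ∀ e e′ → E.singleton (inj₁ e) (inj₂ e′) ≡ false
  singleton-inj₁-inj₂ e e′ = dec-false (inj₁ e E.≟ inj₂ e′) λ ()

  singleton-inj₂-inj₁ : ∀ e e′ → E.singleton (inj₂ e) (inj₁ e′) ≡ false
  singleton-inj₂-inj₁ e e′ = dec-false (inj₂ e E.≟ inj₁ e′) λ ()

sequence≡ : {u v : Sequence n r} → proj₁ u ≡ proj₁ v → u ≡ v
sequence≡ {u = _ , p} {v = _ , q} refl = cong (_ ,_) (ℕ.≡-irrelevant p q)

module _ {E₁ : FiniteSet m a} {E₂ : FiniteSet n b} (M₁ : Matroid E₁) (M₂ : Matroid E₂) where
  private
    module M₁ = Matroid M₁
    module M₂ = Matroid M₂
    module M  = Matroid (M₁ ⊕ M₂)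

  -- A letter from one side leaves the trace of `X` on the other side unchanged, so that side's rank
  -- cancels from the increment. The traces are separate arguments `X₁` and `X₂` because after each
  -- letter they match the expected sets only pointwise.
  increments-⊕ : ∀ (P : Positions k) X X₁ X₂ → X ∘ inj₁ ≗ X₁ → X ∘ inj₂ ≗ X₂ → ∀ αs βs →
    increments (E₁ ⊎ᶠ E₂) M.rk X (interleave-⊎ P αs βs) ≡
    interleave P (increments E₁ M₁.rk X₁ αs) (increments E₂ M₂.rk X₂ βs)
  increments-⊕ []          X X₁ X₂ eq₁ eq₂ []       []       = refl
  increments-⊕ (true  ∷ P) X X₁ X₂ eq₁ eq₂ (α ∷ αs) βs       = cong₂ _∷_
    (trans
      -- The unchanged summand `M₂.rk X₂` is moved to the front of both sums, where it cancels under
      -- `∸`.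
      (cong₂ _∸_
        (trans (cong₂ _+_ (rk-cong M₁ eq₁′) (rk-cong M₂ eq₂′)) (ℕ.+-comm _ (M₂.rk X₂)))
        (trans (cong₂ _+_ (rk-cong M₁ eq₁)  (rk-cong M₂ eq₂))  (ℕ.+-comm _ (M₂.rk X₂))))
      ([m+n]∸[m+o]≡n∸o (M₂.rk X₂) _ _))
    (increments-⊕ P _ _ _ eq₁′ eq₂′ αs βs)
    where
    eq₁′ = λ e → cong₂ _∨_ (eq₁ e) (singleton-inj₁ E₁ E₂ α e)
    eq₂′ = λ e → trans (cong₂ _∨_ (eq₂ e) (singleton-inj₁-inj₂ E₁ E₂ α e)) (∨-identityʳ _)
  increments-⊕ (false ∷ P) X X₁ X₂ eq₁ eq₂ αs       (β ∷ βs) = cong₂ _∷_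
    (trans
      (cong₂ _∸_
        (cong₂ _+_ (rk-cong M₁ eq₁′) (rk-cong M₂ eq₂′))
        (cong₂ _+_ (rk-cong M₁ eq₁)  (rk-cong M₂ eq₂)))
      ([m+n]∸[m+o]≡n∸o (M₁.rk X₁) _ _))
    (increments-⊕ P _ _ _ eq₁′ eq₂′ αs βs)
    where
    eq₁′ = λ e → trans (cong₂ _∨_ (eq₁ e) (singleton-inj₂-inj₁ E₁ E₂ β e)) (∨-identityʳ _)
    eq₂′ = λ e → cong₂ _∨_ (eq₂ e) (singleton-inj₂ E₁ E₂ β e)

  -- Only the word of `π` is prescribed, since its proof of bijectivity may be any one. The
  -- comparison takes place in `ℕ`, through the injective `toℕ`, where `increments-⊕` applies.
  rankSequence-⊕ : (π : Ordering (E₁ ⊎ᶠ E₂)) (π₁ : Ordering E₁) (π₂ : Ordering E₂) →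
    (𝑷 : PositionSet m n) →
    proj₁ π ≡ combine 𝑷 (proj₁ π₁) (proj₁ π₂) →
    rankSequence (M₁ ⊕ M₂) π ≡ shuffle (rankSequence M₁ π₁) (rankSequence M₂ π₂) 𝑷
  rankSequence-⊕ π π₁ π₂ 𝑷@(P , eq) π≡ = sequence≡ (map-injective Fin.toℕ-injective (begin
    Vec.map toℕ (proj₁ (rankSequence (M₁ ⊕ M₂) π))
      ≡⟨ toℕ-rankSequence (M₁ ⊕ M₂) π ⟩
    rankIncrements (M₁ ⊕ M₂) (proj₁ π)
      ≡⟨ cong (rankIncrements (M₁ ⊕ M₂)) π≡ ⟩
    rankIncrements (M₁ ⊕ M₂) (interleave-⊎ P w₁ w₂)
      ≡⟨ increments-⊕ P _ _ _ (λ _ → refl) (λ _ → refl) w₁ w₂ ⟩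
    interleave P (rankIncrements M₁ w₁) (rankIncrements M₂ w₂)
      ≡⟨ cong₂ (interleave P) (cast-rank M₁ eq₁ π₁) (cast-rank M₂ eq₂ π₂) ⟩
    interleave P (Vec.map toℕ (cast eq₁ s₁)) (Vec.map toℕ (cast eq₂ s₂))
      ≡⟨ map-interleave toℕ P (cast eq₁ s₁) (cast eq₂ s₂) ⟨
    Vec.map toℕ (interleave P (cast eq₁ s₁) (cast eq₂ s₂))
      ∎))
    where
    open ≡-Reasoning
    eq₁ = sym eq
    eq₂ = sym (∣∁∣ 𝑷)
    w₁ = cast eq₁ (proj₁ π₁)
    w₂ = cast eq₂ (proj₁ π₂)
    s₁ = proj₁ (rankSequence M₁ π₁)
    s₂ = proj₁ (rankSequence M₂ π₂)
    cast-rank : {E : FiniteSet l c} (M : Matroid E) (eq : l ≡ k) (π : Ordering E) →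
      rankIncrements M (cast eq (proj₁ π)) ≡ Vec.map toℕ (cast eq (proj₁ (rankSequence M π)))
    cast-rank {E = E} M eq π = trans (increments-cast E _ _ eq (proj₁ π))
      (trans (cong (cast eq) (sym (toℕ-rankSequence M π))) (sym (map-cast toℕ eq _)))

-- Enumerating a disjoint union

tabulate-↑ : ∀ m (f : Fin (m + n) → A) →
  List.tabulate f ≡ List.tabulate (f ∘ (_↑ˡ n)) ++ List.tabulate (f ∘ (m ↑ʳ_))
tabulate-↑ zero    f = refl
tabulate-↑ (suc m) f = cong (f zero ∷_) (tabulate-↑ m (f ∘ suc))

elements-⊎ : (E₁ : FiniteSet m a) (E₂ : FiniteSet n b) →
  FiniteSet.elements (E₁ ⊎ᶠ E₂) ≡
  List.map inj₁ (FiniteSet.elements E₁) ++ List.map inj₂ (FiniteSet.elements E₂)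
elements-⊎ {m = m} {n = n} E₁ E₂ = trans (tabulate-↑ m E.element) (cong₂ _++_
  (trans (List.tabulate-cong λ i → cong elt (splitAt-↑ˡ m i n)) (sym (map-tabulate E₁.element inj₁)))
  (trans (List.tabulate-cong λ i → cong elt (splitAt-↑ʳ m n i)) (sym (map-tabulate E₂.element inj₂))))
  where
  module E₁ = FiniteSet E₁
  module E₂ = FiniteSet E₂
  module E  = FiniteSet (E₁ ⊎ᶠ E₂)
  elt : Fin m ⊎ Fin n → E.Carrier
  elt = Sum.map E₁.element E₂.element

-- Sums over lists

module Sums (R : CommutativeRing c ℓ) where
  open CommutativeRing R renaming (Carrier to K; _+_ to _⊹_; refl to ≈-refl; sym to ≈-sym;
    trans to ≈-trans; zero to *-zero)
  open CommSemigroup +-commutativeSemigroup using (interchange)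
  open import Relation.Binary.Reasoning.Setoid setoid

  sum : List A → (A → K) → K
  sum []       f = 0#
  sum (x ∷ xs) f = f x ⊹ sum xs f

  sum-cong : (xs : List A) {f g : A → K} → (∀ x → f x ≈ g x) → sum xs f ≈ sum xs g
  sum-cong []       f≈g = ≈-refl
  sum-cong (x ∷ xs) f≈g = +-cong (f≈g x) (sum-cong xs f≈g)

  sum-zero : (xs : List A) {f : A → K} → (∀ x → f x ≈ 0#) → sum xs f ≈ 0#
  sum-zero []       f≈0 = ≈-refl
  sum-zero (x ∷ xs) f≈0 = ≈-trans (+-cong (f≈0 x) (sum-zero xs f≈0)) (+-identityˡ 0#)

  sum-++ : (xs ys : List A) {f : A → K} → sum (xs ++ ys) f ≈ sum xs f ⊹ sum ys f
  sum-++ []       ys = ≈-sym (+-identityˡ _)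
  sum-++ (x ∷ xs) ys = ≈-trans (+-congˡ (sum-++ xs ys)) (≈-sym (+-assoc _ _ _))

  sum-map : (h : A → B) (xs : List A) {f : B → K} → sum (List.map h xs) f ≈ sum xs (f ∘ h)
  sum-map h []       = ≈-refl
  sum-map h (x ∷ xs) = +-congˡ (sum-map h xs)

  sum-+ : (xs : List A) {f g : A → K} → sum xs (λ x → f x ⊹ g x) ≈ sum xs f ⊹ sum xs g
  sum-+ []       = ≈-sym (+-identityˡ 0#)
  sum-+ (x ∷ xs) = ≈-trans (+-congˡ (sum-+ xs)) (interchange _ _ _ _)

  sum-swap : (xs : List A) (ys : List B) {f : A → B → K} →
    sum xs (λ x → sum ys (f x)) ≈ sum ys (λ y → sum xs (λ x → f x y))
  sum-swap []       ys = ≈-sym (sum-zero ys λ _ → ≈-refl)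
  sum-swap (x ∷ xs) ys = ≈-trans (+-congˡ (sum-swap xs ys)) (≈-sym (sum-+ ys))

  sum-*ˡ : (xs : List A) {f : A → K} (y : K) → sum xs (λ x → y * f x) ≈ y * sum xs f
  sum-*ˡ []       y = ≈-sym (zeroʳ y)
  sum-*ˡ (x ∷ xs) y = ≈-trans (+-congˡ (sum-*ˡ xs y)) (≈-sym (distribˡ y _ _))

  sum-*ʳ : (xs : List A) {f : A → K} (y : K) → sum xs (λ x → f x * y) ≈ sum xs f * y
  sum-*ʳ []       y = ≈-sym (zeroˡ y)
  sum-*ʳ (x ∷ xs) y = ≈-trans (+-congˡ (sum-*ʳ xs y)) (≈-sym (distribʳ y _ _))

  sum-cartesianProductWith : (h : A → B → C) (xs : List A) (ys : List B) {f : C → K} →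
    sum (cartesianProductWith h xs ys) f ≈ sum xs (λ x → sum ys (λ y → f (h x y)))
  sum-cartesianProductWith h []       ys = ≈-refl
  sum-cartesianProductWith h (x ∷ xs) ys = ≈-trans (sum-++ (List.map (h x) ys) _)
    (+-cong (sum-map (h x) ys) (sum-cartesianProductWith h xs ys))

  -- Without function extensionality an ordering carries a non-unique proof of
  -- bijectivity, so sums over orderings are compared as guarded sums over words.
  guard : {P : Set p} → Dec P → (P → K) → K
  guard (yes q) f = f q
  guard (no _)  f = 0#

  -- The value is demanded at every proof because the one stored in `d` may differ from the one
  -- supplied.
  guard-yes : {P : Set p} (d : Dec P) {f : P → K} {y : K} → P → (∀ q → f q ≈ y) → guard d f ≈ y
  guard-yes (yes q) _ f≈y = f≈y q
  guard-yes (no ¬q) q _   = contradiction q ¬q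

  guard-no : {P : Set p} (d : Dec P) {f : P → K} → ¬ P → guard d f ≈ 0#
  guard-no (yes q) ¬q = contradiction q ¬q
  guard-no (no _)  _  = ≈-refl

  sum-guard : {P : Set p} (d : Dec P) (xs : List A) {f : A → P → K} →
    sum xs (λ x → guard d (f x)) ≈ guard d (λ q → sum xs (λ x → f x q))
  sum-guard (yes q) xs = ≈-refl
  sum-guard (no _)  xs = sum-zero xs λ _ → ≈-refl

  sum-select : {P : Pred A p} (P? : Decidable P) (xs : List A) {f : Σ A P → K} →
    sum (select P? xs) f ≈ sum xs (λ x → guard (P? x) (λ q → f (x , q)))
  sum-select P? []       = ≈-refl
  sum-select P? (x ∷ xs) with P? x
  ... | yes q = +-congˡ (sum-select P? xs)
  ... | no  _ = ≈-trans (sum-select P? xs) (≈-sym (+-identityˡ _))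

  -- x occurs exactly once in xs, as seen by sums of functions supported at x.
  Picks : List A → A → Set _
  Picks xs x = ∀ f → (∀ y → x ≢ y → f y ≈ 0#) → sum xs f ≈ f x

  words-picks : (xs : List A) → (∀ x → Picks xs x) → (w : Vec A n) → Picks (words xs n) w
  words-picks             xs picks []      f f≈0 = +-identityʳ _
  words-picks {n = suc n} xs picks (x ∷ w) f f≈0 = begin
    sum (words xs (suc n)) f
      ≈⟨ sum-cartesianProductWith _∷_ xs (words xs n) ⟩
    sum xs (λ y → sum (words xs n) (λ v → f (y ∷ v)))
      -- A head other than `x` makes the whole inner sum vanish.
      ≈⟨ picks x _ (λ y x≢y → sum-zero (words xs n) λ v → f≈0 _ λ where refl → x≢y refl) ⟩
    sum (words xs n) (λ v → f (x ∷ v))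
      ≈⟨ words-picks xs picks w _ (λ v w≢v → f≈0 _ λ where refl → w≢v refl) ⟩
    f (x ∷ w) ∎

  -- Irrelevance makes a selected pair depend on its first component alone, so a function supported
  -- at `(x , q)` comes from a guarded function supported at `x`.
  select-picks : {P : Pred A p} (P? : Decidable P) → Irrelevant P → (xs : List A) →
    ∀ x (q : P x) → Picks xs x → Picks (select P? xs) (x , q)
  select-picks P? irr xs x q picks f f≈0 = begin
    sum (select P? xs) f
      ≈⟨ sum-select P? xs ⟩
    sum xs (λ y → guard (P? y) (λ q′ → f (y , q′)))
      ≈⟨ picks _ (λ y x≢y → guard-zero (P? y) λ q′ → f≈0 _ λ where refl → x≢y refl) ⟩
    guard (P? x) (λ q′ → f (x , q′))
      ≈⟨ guard-yes (P? x) q (λ q′ → reflexive (cong (λ q → f (x , q)) (irr q′ q))) ⟩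
    f (x , q) ∎
    where
    guard-zero : {Q : Set p} (d : Dec Q) {f : Q → K} → (∀ q → f q ≈ 0#) → guard d f ≈ 0#
    guard-zero (yes q) f≈0 = f≈0 q
    guard-zero (no _)  _   = ≈-refl

  -- Hence `sequences` lists the basis symbols without omission or repetition.
  sequences-picks : (u : Sequence n r) → Picks (sequences n r) u
  sequences-picks {r = r} (w , q) =
    select-picks (λ v → ones v ℕ.≟ r) ℕ.≡-irrelevant (words digits _) w q (words-picks digits digit w)
    where
    digits = zero ∷ suc zero ∷ []

    digit : ∀ x → Picks digits x
    digit zero       f f≈0 = ≈-trans
      (+-congˡ (≈-trans (+-identityʳ _) (f≈0 (suc zero) λ ()))) (+-identityʳ _)
    digit (suc zero) f f≈0 = ≈-trans
      (+-cong (f≈0 zero λ ()) (+-identityʳ _)) (+-identityˡ _)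

  sum-words-cast : (xs : List A) (eq : m ≡ n) {f : Vec A n → K} →
    sum (words xs n) f ≈ sum (words xs m) (f ∘ cast eq)
  sum-words-cast {n = n} xs refl {f} =
    sum-cong (words xs n) λ w → reflexive (cong f (sym (cast-is-id refl w)))

  -- Induction on the length: the side of the first letter decides the first entry of `P`, and the
  -- letter becomes the head of the corresponding piece.
  sum-words-⊎ : (xs : List A) (ys : List B) → ∀ k {f : Vec (A ⊎ B) k → K} →
    sum (words (List.map inj₁ xs ++ List.map inj₂ ys) k) f ≈
    sum (words (true ∷ false ∷ []) k) λ P →
      sum (words xs ∣ P ∣) λ αs → sum (words ys ∣ ∁ P ∣) λ βs → f (interleave-⊎ P αs βs)
  sum-words-⊎ xs ys zero    = ≈-sym (≈-trans (+-identityʳ _) (+-identityʳ _))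
  sum-words-⊎ xs ys (suc k) {f} = begin
    sum (words zs (suc k)) f
      ≈⟨ sum-cartesianProductWith _∷_ zs (words zs k) ⟩
    sum zs (λ z → sum (words zs k) (λ w → f (z ∷ w)))
      ≈⟨ sum-cong zs (λ z → sum-words-⊎ xs ys k) ⟩
    sum zs g
      ≈⟨ sum-++ (List.map inj₁ xs) _ ⟩
    sum (List.map inj₁ xs) g ⊹ sum (List.map inj₂ ys) g
      ≈⟨ +-cong (sum-map inj₁ xs) (sum-map inj₂ ys) ⟩
    sum xs (g ∘ inj₁) ⊹ sum ys (g ∘ inj₂)
      ≈⟨ +-cong (sum-swap xs Ps) (sum-swap ys Ps) ⟩
    sum Ps (λ P → sum xs λ x → G P (inj₁ x)) ⊹ sum Ps (λ P → sum ys λ y → G P (inj₂ y))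
      ≈⟨ +-cong
           (sum-cong Ps λ P → ≈-sym (sum-cartesianProductWith _∷_ xs (words xs ∣ P ∣)))
           -- A right letter heads `βs`, whose sum is innermost, so it must first pass the sum over
           -- `αs`.
           (sum-cong Ps λ P → ≈-trans (sum-swap ys (words xs ∣ P ∣))
             (sum-cong (words xs ∣ P ∣) λ αs →
               ≈-sym (sum-cartesianProductWith _∷_ ys (words ys ∣ ∁ P ∣)))) ⟩
    sum Ps (F ∘ (true ∷_)) ⊹ sum Ps (F ∘ (false ∷_))
      ≈⟨ +-congˡ (+-identityʳ _) ⟨
    sum Ps (F ∘ (true ∷_)) ⊹ (sum Ps (F ∘ (false ∷_)) ⊹ 0#)
      ≈⟨ sum-cartesianProductWith _∷_ (true ∷ false ∷ []) Ps ⟨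
    sum (words (true ∷ false ∷ []) (suc k)) F ∎
    where
    zs = List.map inj₁ xs ++ List.map inj₂ ys
    Ps = words (true ∷ false ∷ []) k
    G : Positions k → _ → K
    G P z = sum (words xs ∣ P ∣) λ αs → sum (words ys ∣ ∁ P ∣) λ βs → f (z ∷ interleave-⊎ P αs βs)
    g : _ → K
    g z = sum Ps λ P → G P z
    F : Positions (suc k) → K
    F P = sum (words xs ∣ P ∣) λ αs → sum (words ys ∣ ∁ P ∣) λ βs → f (interleave-⊎ P αs βs)

  -- `Q`, `Q₁` and `Q₂` abstract bijectivity of the three words. `Q-combine` speaks only of position
  -- sets of size `m`; `Q⇒∣P∣≡m` disposes of all other sizes.
  module _ {Q : Pred (Vec (A ⊎ B) (m + n)) p} {Q₁ : Pred (Vec A m) p₁} {Q₂ : Pred (Vec B n) p₂}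
    (Q? : Decidable Q) (Q₁? : Decidable Q₁) (Q₂? : Decidable Q₂)
    (Q⇒∣P∣≡m : ∀ P {αs βs} → Q (interleave-⊎ P αs βs) → ∣ P ∣ ≡ m)
    (Q-combine : ∀ 𝑷 αs βs → Q (combine 𝑷 αs βs) ⇔ (Q₁ αs × Q₂ βs))
    (xs : List A) (ys : List B)
    (f : Σ _ Q → K) (g : PositionSet m n → Σ _ Q₁ → Σ _ Q₂ → K)
    (f≈g : ∀ 𝑷 π₁ π₂ q → f (combine 𝑷 (proj₁ π₁) (proj₁ π₂) , q) ≈ g 𝑷 π₁ π₂)
    where
    private
      Ws  = words (List.map inj₁ xs ++ List.map inj₂ ys) (m + n)
      W₁  = words xs m
      W₂  = words ys n
      Π₁  = select Q₁? W₁
      Π₂  = select Q₂? W₂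
      Ps  = words (true ∷ false ∷ []) (m + n)

      f? : Vec (A ⊎ B) (m + n) → K
      f? w = guard (Q? w) λ q → f (w , q)

      -- If either component fails its test, so does the combined word, and both sides vanish. The
      -- decisions are arguments so that matching on them reduces the guards.
      combine-fixed : ∀ 𝑷 αs (d₁ : Dec (Q₁ αs)) βs (d₂ : Dec (Q₂ βs)) →
        f? (combine 𝑷 αs βs) ≈ guard d₁ λ q₁ → guard d₂ λ q₂ → g 𝑷 (αs , q₁) (βs , q₂)
      combine-fixed 𝑷 αs (no ¬q₁) βs d₂ =
        guard-no (Q? _) (¬q₁ ∘ proj₁ ∘ Equivalence.to (Q-combine 𝑷 αs βs))
      combine-fixed 𝑷 αs (yes q₁) βs (no ¬q₂) =
        guard-no (Q? _) (¬q₂ ∘ proj₂ ∘ Equivalence.to (Q-combine 𝑷 αs βs))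
      combine-fixed 𝑷 αs (yes q₁) βs (yes q₂) =
        guard-yes (Q? _) (Equivalence.from (Q-combine 𝑷 αs βs) (q₁ , q₂))
          (f≈g 𝑷 (αs , q₁) (βs , q₂))

      -- For a wrong size no term survives. For size `m` the casts bring both words to the lengths
      -- at which `Q₁` and `Q₂` are stated.
      positions-fixed : ∀ P (d : Dec (∣ P ∣ ≡ m)) →
        sum (words xs ∣ P ∣) (λ αs → sum (words ys ∣ ∁ P ∣) λ βs → f? (interleave-⊎ P αs βs)) ≈
        guard d (λ eq → sum Π₁ λ π₁ → sum Π₂ λ π₂ → g (P , eq) π₁ π₂)
      positions-fixed P (no ∣P∣≢m) = sum-zero (words xs ∣ P ∣) λ αs →
        sum-zero (words ys ∣ ∁ P ∣) λ βs → guard-no (Q? _) (∣P∣≢m ∘ Q⇒∣P∣≡m P)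
      positions-fixed P (yes eq) = begin
        sum (words xs ∣ P ∣) (λ αs → sum (words ys ∣ ∁ P ∣) λ βs → f? (interleave-⊎ P αs βs))
          ≈⟨ sum-words-cast xs (sym eq) ⟩
        sum W₁ (λ αs → sum (words ys ∣ ∁ P ∣) λ βs → f? (interleave-⊎ P (cast (sym eq) αs) βs))
          ≈⟨ sum-cong W₁ (λ αs → sum-words-cast ys (sym (∣∁∣ (P , eq)))) ⟩
        sum W₁ (λ αs → sum W₂ λ βs → f? (combine (P , eq) αs βs))
          ≈⟨ sum-cong W₁ (λ αs → sum-cong W₂ λ βs →
               combine-fixed (P , eq) αs (Q₁? αs) βs (Q₂? βs)) ⟩
        sum W₁ (λ αs → sum W₂ λ βs → guard (Q₁? αs) λ q₁ → guard (Q₂? βs) λ q₂ →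
          g (P , eq) (αs , q₁) (βs , q₂))
          -- The test on `αs` is independent of `βs`, so its guard leaves the inner sum and both
          -- guarded sums fold back into selections.
          ≈⟨ sum-cong W₁ (λ αs → sum-guard (Q₁? αs) W₂) ⟩
        sum W₁ (λ αs → guard (Q₁? αs) λ q₁ → sum W₂ λ βs → guard (Q₂? βs) λ q₂ →
          g (P , eq) (αs , q₁) (βs , q₂))
          ≈⟨ sum-select Q₁? W₁ ⟨
        sum Π₁ (λ π₁ → sum W₂ λ βs → guard (Q₂? βs) λ q₂ → g (P , eq) π₁ (βs , q₂))
          ≈⟨ sum-cong Π₁ (λ π₁ → sum-select Q₂? W₂) ⟨
        sum Π₁ (λ π₁ → sum Π₂ λ π₂ → g (P , eq) π₁ π₂) ∎

    sum-select-⊎ : sum (select Q? Ws) f ≈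
      sum Π₁ λ π₁ → sum Π₂ λ π₂ → sum (positionSets m n) λ 𝑷 → g 𝑷 π₁ π₂
    sum-select-⊎ = begin
      sum (select Q? Ws) f
        ≈⟨ sum-select Q? Ws ⟩
      sum Ws f?
        ≈⟨ sum-words-⊎ xs ys (m + n) ⟩
      sum Ps (λ P → sum (words xs ∣ P ∣) λ αs → sum (words ys ∣ ∁ P ∣) λ βs →
        f? (interleave-⊎ P αs βs))
        ≈⟨ sum-cong Ps (λ P → positions-fixed P (∣ P ∣ ℕ.≟ m)) ⟩
      sum Ps (λ P → guard (∣ P ∣ ℕ.≟ m) λ eq → sum Π₁ λ π₁ → sum Π₂ λ π₂ → g (P , eq) π₁ π₂)
        ≈⟨ sum-select (λ P → ∣ P ∣ ℕ.≟ m) Ps ⟨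
      sum (positionSets m n) (λ 𝑷 → sum Π₁ λ π₁ → sum Π₂ λ π₂ → g 𝑷 π₁ π₂)
        -- The sum over position sets moves innermost, where the shuffle product has it.
        ≈⟨ sum-swap (positionSets m n) Π₁ ⟩
      sum Π₁ (λ π₁ → sum (positionSets m n) λ 𝑷 → sum Π₂ λ π₂ → g 𝑷 π₁ π₂)
        ≈⟨ sum-cong Π₁ (λ π₁ → sum-swap (positionSets m n) Π₂) ⟩
      sum Π₁ (λ π₁ → sum Π₂ λ π₂ → sum (positionSets m n) λ 𝑷 → g 𝑷 π₁ π₂) ∎

-- Bilinear expansion of the shuffle product

module _ (𝕂 : HeytingField c ℓ₁ ℓ₂) where
  private
    R = HeytingCommutativeRing.commutativeRing (HeytingField.heytingCommutativeRing 𝕂)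
  open GInvariant 𝕂 using (Space; 𝒢; [_]≀[_]; _≀_; ∑; [_])
  open CommutativeRing R renaming (Carrier to K; _+_ to _⊹_; refl to ≈-refl; sym to ≈-sym;
    trans to ≈-trans; zero to *-zero)
  open Sums R
  open import Relation.Binary.Reasoning.Setoid setoid

  ∑-at : (xs : List A) (f : A → Space n r) → ∀ t → ∑ xs f t ≡ sum xs (λ x → f x t)
  ∑-at []       f t = refl
  ∑-at (x ∷ xs) f t = cong (f x t ⊹_) (∑-at xs f t)

  -- `[ u ]` is a Kronecker delta, so a single term survives.
  sum-symbol : (u : Sequence n r) (g : Sequence n r → K) →
    sum (sequences n r) (λ v → [ u ] v * g v) ≈ g u
  sum-symbol u g = ≈-trans (sequences-picks u _ away) at
    where
    away : ∀ v → u ≢ v → [ u ] v * g v ≈ 0#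
    away v u≢v rewrite dec-false (sequence≟ u v) u≢v = zeroˡ _
    at : [ u ] u * g u ≈ g u
    at rewrite dec-true (sequence≟ u u) refl = *-identityˡ _

  -- The left side is the linear extension of `g` from the symbols, evaluated at a sum of symbols;
  -- linearity reduces it to a single symbol.
  sum-∑-symbols : (xs : List A) (h : A → Sequence n r) (g : Sequence n r → K) →
    sum (sequences n r) (λ v → ∑ xs (λ x → [ h x ]) v * g v) ≈ sum xs (g ∘ h)
  sum-∑-symbols {n = n} {r = r} xs h g = begin
    sum S (λ v → ∑ xs (λ x → [ h x ]) v * g v)
      ≈⟨ sum-cong S (λ v → *-congʳ (reflexive (∑-at xs _ v))) ⟩
    sum S (λ v → sum xs (λ x → [ h x ] v) * g v)
      ≈⟨ sum-cong S (λ v → sum-*ʳ xs (g v)) ⟨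
    sum S (λ v → sum xs (λ x → [ h x ] v * g v))
      ≈⟨ sum-swap S xs ⟩
    sum xs (λ x → sum S (λ v → [ h x ] v * g v))
      ≈⟨ sum-cong xs (λ x → sum-symbol (h x) g) ⟩
    sum xs (g ∘ h) ∎
    where S = sequences n r

  -- `sum-∑-symbols` is applied once in each argument: to `g` with `u` fixed, after `f u` has been
  -- pulled out, and then to `f`.
  ≀-symbols : (xs : List A) (ys : List B) (h₁ : A → Sequence m r) (h₂ : B → Sequence n s) → ∀ t →
    (∑ xs (λ x → [ h₁ x ]) ≀ ∑ ys (λ y → [ h₂ y ])) t ≈
    sum xs λ x → sum ys λ y → sum (positionSets m n) λ P → [ shuffle (h₁ x) (h₂ y) P ] t
  ≀-symbols {m = m} {r = r} {n = n} {s = s} xs ys h₁ h₂ t = begin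
    (f ≀ g) t
      ≈⟨ reflexive (∑-at (sequences m r) _ t) ⟩
    sum (sequences m r) (λ u → ∑ (sequences n s) (λ v t → (f u * g v) * [ u ]≀[ v ] t) t)
      ≈⟨ sum-cong (sequences m r) (λ u → begin
           ∑ (sequences n s) (λ v t → (f u * g v) * [ u ]≀[ v ] t) t
             ≈⟨ reflexive (∑-at (sequences n s) _ t) ⟩
           sum (sequences n s) (λ v → (f u * g v) * [ u ]≀[ v ] t)
             ≈⟨ sum-cong (sequences n s) (λ v → *-assoc _ _ _) ⟩
           sum (sequences n s) (λ v → f u * (g v * [ u ]≀[ v ] t))
             ≈⟨ sum-*ˡ (sequences n s) (f u) ⟩
           f u * sum (sequences n s) (λ v → g v * [ u ]≀[ v ] t)
             ≈⟨ *-congˡ (sum-∑-symbols ys h₂ (λ v → [ u ]≀[ v ] t)) ⟩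
           f u * sum ys (λ y → [ u ]≀[ h₂ y ] t) ∎) ⟩
    sum (sequences m r) (λ u → f u * sum ys (λ y → [ u ]≀[ h₂ y ] t))
      ≈⟨ sum-∑-symbols xs h₁ _ ⟩
    sum xs (λ x → sum ys (λ y → [ h₁ x ]≀[ h₂ y ] t))
      ≈⟨ sum-cong xs (λ x → sum-cong ys λ y → reflexive (∑-at (positionSets m n) _ t)) ⟩
    sum xs (λ x → sum ys λ y → sum (positionSets m n) λ P → [ shuffle (h₁ x) (h₂ y) P ] t) ∎
    where
    f = ∑ xs (λ x → [ h₁ x ])
    g = ∑ ys (λ y → [ h₂ y ])

  𝒢-⊕ : {E₁ : FiniteSet m a} {E₂ : FiniteSet n b} (M₁ : Matroid E₁) (M₂ : Matroid E₂) →
    ∀ t → 𝒢 (M₁ ⊕ M₂) t ≈ (𝒢 M₁ ≀ 𝒢 M₂) t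
  𝒢-⊕ {m = m} {n = n} {E₁ = E₁} {E₂ = E₂} M₁ M₂ t = begin
    𝒢 (M₁ ⊕ M₂) t
      ≈⟨ reflexive (∑-at (orderings E) (λ π → [ rankSequence (M₁ ⊕ M₂) π ]) t) ⟩
    sum (orderings E) f
      -- The alphabet underlying `orderings E` is rewritten as two tagged lists, the form that
      -- `sum-select-⊎` expects.
      ≈⟨ reflexive (cong (λ es → sum (select (bijective? E) (words es (m + n))) f)
           (elements-⊎ E₁ E₂)) ⟩
    sum (select (bijective? E)
      (words (List.map inj₁ E₁.elements ++ List.map inj₂ E₂.elements) (m + n))) f
      ≈⟨ sum-select-⊎ (bijective? E) (bijective? E₁) (bijective? E₂)
           (λ P {αs} {βs} → covers-interleave⇒∣P∣ E₁ E₂ P {αs} {βs} ∘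
             Equivalence.to (bijective⇔covers E {interleave-⊎ P αs βs}))
           (combine-bijective E₁ E₂)
           E₁.elements E₂.elements f g
           (λ 𝑷 π₁ π₂ q → reflexive (cong (λ u → [ u ] t)
             (rankSequence-⊕ M₁ M₂ (combine 𝑷 (proj₁ π₁) (proj₁ π₂) , q) π₁ π₂ 𝑷 refl))) ⟩
    sum (orderings E₁) (λ π₁ → sum (orderings E₂) λ π₂ → sum (positionSets m n) λ 𝑷 → g 𝑷 π₁ π₂)
      ≈⟨ ≀-symbols (orderings E₁) (orderings E₂) (rankSequence M₁) (rankSequence M₂) t ⟨
    (𝒢 M₁ ≀ 𝒢 M₂) t ∎
    where
    module E₁ = FiniteSet E₁
    module E₂ = FiniteSet E₂
    E = E₁ ⊎ᶠ E₂
    f : Ordering E → K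
    f π = [ rankSequence (M₁ ⊕ M₂) π ] t
    g : PositionSet m n → Ordering E₁ → Ordering E₂ → K
    g 𝑷 π₁ π₂ = [ shuffle (rankSequence M₁ π₁) (rankSequence M₂ π₂) 𝑷 ] t

proposition4p3 : {c ℓ₁ ℓ₂ a b : Level} (K : HeytingField c ℓ₁ ℓ₂) → CharacteristicZero K →
    {n₁ n₂ : ℕ} {E₁ : FiniteSet n₁ a} {E₂ : FiniteSet n₂ b}
    (M₁ : Matroid E₁) (M₂ : Matroid E₂) →
    let open GInvariant K in
    𝒢 (M₁ ⊕ M₂) ≈ 𝒢 M₁ ≀ 𝒢 M₂
proposition4p3 K _ = 𝒢-⊕ K
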